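{- For every integer $k\geq 1$, the median hypersimplex $\Delta_{2k,k}$ is Minkowski indecomposable. That is, whenever $\lambda\Delta_{2k,k}=Q+R$ with $\lambda>0$ and $Q,R$ convex polytopes, both $Q$ and $R$ are homothetic translates of $\Delta_{2k,k}$.
   Context: For integers $n$ and $r$, the hypersimplex $\Delta_{n,r}\subset\mathbb{R}^n$ is the convex hull of all vertices of the cube $[0,1]^n$ (i.e. $0/1$-vectors) that lie on the hyperplane $x_1+\dots+x_n=r$. The hypersimplex $\Delta_{2k,k}$ is called the median hypersimplex. The sum $Q+R=\{q+r \mid q\in Q,\ r\in R\}$ is the Minkowski sum. A polytope $Q$ is a homothetic translate of $P$ if $Q=\mu P+v$ for some real $\mu\geq 0$ and some vector $v$ (the case $\mu=0$, a single point, is allowed). -}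

module Defs where

open import Level using (0ℓ; suc)
open import Algebra.Bundles using (CommutativeRing)
import Algebra.Definitions.RawMonoid as RawMonoidDefs
open import Data.Nat using (ℕ)
open import Data.Product using (Σ-syntax; ∃-syntax; _×_)
open import Data.Sum using (_⊎_)
open import Data.Vec.Functional using (Vector)
open import Relation.Binary.Core using (Rel)
open import Relation.Binary.Structures using (IsDecTotalOrder)
import Relation.Binary.Construct.NonStrictToStrict as ToStrict
open import Relation.Unary using (Pred; _∈_; _≐_; Satisfiable)

record OrderedField : Set (suc 0ℓ) where
  field
    commutativeRing : CommutativeRing 0ℓ 0ℓ

  open CommutativeRing commutativeRing public

  infix 4 _≤_

  field
    _≤_             : Rel Carrier 0ℓ
    isDecTotalOrder : IsDecTotalOrder _≈_ _≤_
    1≉0             : 1# ≉ 0#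
    inverse         : ∀ x → x ≉ 0# → ∃[ y ] x * y ≈ 1#
    +-monoʳ-≤       : ∀ x {y z} → y ≤ z → x + y ≤ x + z
    *-nonNegative   : ∀ {x y} → 0# ≤ x → 0# ≤ y → 0# ≤ x * y

  infix 4 _<_

  _<_ : Rel Carrier 0ℓ
  _<_ = ToStrict._<_ _≈_ _≤_

-- The real numbers, characterised up to unique isomorphism as the
-- Dedekind-complete ordered field.  The order of ℝ is the classical
-- one, hence decidable; building an instance therefore takes excluded
-- middle, which is consistent with but not provable in Agda.
record RealNumbers : Set (suc 0ℓ) where
  field
    orderedField : OrderedField

  open OrderedField orderedField public

  UpperBound : Pred Carrier 0ℓ → Pred Carrier 0ℓ
  UpperBound S b = ∀ x → x ∈ S → x ≤ b

  field
    supremum : (S : Pred Carrier 0ℓ) → Satisfiable S →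
               Satisfiable (UpperBound S) →
               ∃[ s ] (s ∈ UpperBound S × (∀ b → b ∈ UpperBound S → s ≤ b))

module Polytopes (K : OrderedField) where

  open OrderedField K
  open RawMonoidDefs +-rawMonoid using (sum) renaming (_×_ to _×ᴷ_)

  Point : ℕ → Set
  Point n = Vector Carrier n

  PointSet : ℕ → Set (suc 0ℓ)
  PointSet n = Pred (Point n) 0ℓ

  infix  4 _≋_
  infixl 6 _⊹_
  infixr 7 _·_

  _≋_ : ∀ {n} → Rel (Point n) 0ℓ
  x ≋ y = ∀ i → x i ≈ y i

  _⊹_ : ∀ {n} → Point n → Point n → Point n
  (x ⊹ y) i = x i + y i

  _·_ : ∀ {n} → Carrier → Point n → Point n
  (c · x) i = c * x i

  ConvexHull : ∀ {n} → PointSet n → PointSet n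
  ConvexHull A x =
    ∃[ m ] Σ[ p ∈ Vector (Point _) m ] Σ[ w ∈ Vector Carrier m ]
      (∀ j → p j ∈ A) × (∀ j → 0# ≤ w j) × sum w ≈ 1# ×
      (∀ i → x i ≈ sum (λ j → w j * p j i))

  IsPolytope : ∀ {n} → Pred (PointSet n) 0ℓ
  IsPolytope {n} Q =
    ∃[ m ] Σ[ p ∈ Vector (Point n) m ]
      Q ≐ ConvexHull (λ x → ∃[ j ] x ≋ p j)

  infixl 6 _⊕_
  infixr 7 _⊙_

  _⊕_ : ∀ {n} → PointSet n → PointSet n → PointSet n
  (Q ⊕ R) x = ∃[ q ] ∃[ r ] q ∈ Q × r ∈ R × x ≋ q ⊹ r

  _⊙_ : ∀ {n} → Carrier → PointSet n → PointSet n
  (c ⊙ P) x = ∃[ p ] p ∈ P × x ≋ c · p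

  translate : ∀ {n} → Point n → PointSet n → PointSet n
  translate v P x = ∃[ p ] p ∈ P × x ≋ p ⊹ v

  HomotheticTranslate : ∀ {n} → PointSet n → PointSet n → Set
  HomotheticTranslate {n} Q P =
    ∃[ μ ] Σ[ v ∈ Point n ] 0# ≤ μ × Q ≐ translate v (μ ⊙ P)

  MinkowskiIndecomposable : ∀ {n} → PointSet n → Set (suc 0ℓ)
  MinkowskiIndecomposable {n} P =
    ∀ (c : Carrier) (Q R : PointSet n) → 0# < c →
    IsPolytope Q → IsPolytope R → c ⊙ P ≐ Q ⊕ R →
    HomotheticTranslate Q P × HomotheticTranslate R P

  IsCubeVertex : ∀ {n} → PointSet n
  IsCubeVertex x = ∀ i → x i ≈ 0# ⊎ x i ≈ 1#

  hypersimplex : (n r : ℕ) → PointSet n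
  hypersimplex n r = ConvexHull (λ x → IsCubeVertex x × sum x ≈ r ×ᴷ 1#)

{-# OPTIONS --safe #-}
module Submission where

-- For each vertex e of Δ write c e = q_e + s_e with q_e ∈ Q and s_e ∈ R.  Since
-- every point of cΔ has its coordinates in [0, c], q_e maximises the i-th
-- coordinate over Q when e_i = 1 and minimises it when e_i = 0; hence
-- (q_e)_i = m_i + λ_i e_i with m and λ independent of e.  All points of Q have the
-- same coordinate sum, so exchanging one element of a vertex for another forces all
-- λ_i to coincide, and Q contains m + λΔ by convexity.  Conversely a point of Q lies
-- in the box m + [0, λ]ⁿ and has the right coordinate sum, and Δ is exactly the slice
-- of the unit cube at its level.

open import Defs
import Algebra.Properties.Ring as RingProperties
import Algebra.Properties.Semiring.Sum as SemiringSum
import Algebra.Definitions.RawMonoid as RawMonoidDefs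
import Algebra.Solver.Ring.NaturalCoefficients.Default as SemiringSolver
import Data.Nat.Base as ℕ
import Data.Nat.Properties as ℕₚ
open import Data.Nat using (ℕ)
open import Data.Empty using (⊥-elim)
open import Data.Fin.Base using (Fin; zero; suc)
open import Data.Product using (Σ-syntax; ∃-syntax; _×_; _,_; proj₁; proj₂)
open import Data.Sum using (_⊎_; inj₁; inj₂)
open import Data.Vec.Functional using (Vector; []; _∷_; head; tail; insertAt; removeAt)
open import Data.Vec.Functional.Properties using (insertAt-lookup; insertAt-punchIn; removeAt-insertAt)
open import Level using (0ℓ)
open import Relation.Binary.Bundles using (Poset)
open import Relation.Binary.PropositionalEquality as ≡ using (_≡_)
open import Relation.Binary.Structures using (IsDecTotalOrder)
import Relation.Binary.Reasoning.PartialOrder as PartialOrderReasoning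
open import Relation.Nullary using (yes; no)
open import Relation.Unary using (_∈_; _⊆_)

-- Arithmetic of ordered fields.

module OrderedFieldProperties (K : OrderedField) where

  open OrderedField K hiding (zero)
  open IsDecTotalOrder isDecTotalOrder public using (_≟_)
    renaming (refl to ≤-refl; reflexive to ≤-reflexive; trans to ≤-trans; antisym to ≤-antisym; total to ≤-total;
              ≤-respˡ-≈ to ≤-respˡ; ≤-respʳ-≈ to ≤-respʳ; isPartialOrder to ≤-isPartialOrder)
  open RingProperties ring public using (+-cancelˡ; +-cancelʳ; -‿distribˡ-*; -‿involutive)
  open SemiringSolver commutativeSemiring public using (solve; _:=_; _:+_; _:*_; con)
  open RawMonoidDefs +-rawMonoid public using (sum) renaming (_×_ to _×ᴷ_)

  ≤-poset : Poset 0ℓ 0ℓ 0ℓ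
  ≤-poset = record { isPartialOrder = ≤-isPartialOrder }

  module ≤-Reasoning = PartialOrderReasoning ≤-poset
  open ≤-Reasoning

  +-mono-≤ : ∀ {x y u v} → x ≤ y → u ≤ v → x + u ≤ y + v
  +-mono-≤ {x} {y} {u} {v} x≤y u≤v = begin
    x + u ≤⟨ +-monoʳ-≤ x u≤v ⟩
    x + v ≈⟨ +-comm x v ⟩
    v + x ≤⟨ +-monoʳ-≤ v x≤y ⟩
    v + y ≈⟨ +-comm v y ⟩
    y + v ∎

  +-cancelˡ-≤ : ∀ x {y z} → x + y ≤ x + z → y ≤ z
  +-cancelˡ-≤ x {y} {z} p = begin
    y             ≈⟨ undo y ⟨
    - x + (x + y) ≤⟨ +-monoʳ-≤ (- x) p ⟩
    - x + (x + z) ≈⟨ undo z ⟩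
    z             ∎
    where
    undo : ∀ y → - x + (x + y) ≈ y
    undo y = trans (sym (+-assoc (- x) x y)) (trans (+-congʳ (-‿inverseˡ x)) (+-identityˡ y))

  +-cancelʳ-≤ : ∀ x {y z} → y + x ≤ z + x → y ≤ z
  +-cancelʳ-≤ x {y} {z} p = +-cancelˡ-≤ x (≤-respˡ (+-comm y x) (≤-respʳ (+-comm z x) p))

  +-nonNegative : ∀ {x y} → 0# ≤ x → 0# ≤ y → 0# ≤ x + y
  +-nonNegative 0≤x 0≤y = ≤-respˡ (+-identityˡ 0#) (+-mono-≤ 0≤x 0≤y)

  x≤x+y : ∀ x {y} → 0# ≤ y → x ≤ x + y
  x≤x+y x 0≤y = ≤-respˡ (+-identityʳ x) (+-monoʳ-≤ x 0≤y)

  ≤⇒gap : ∀ {x y} → x ≤ y → ∃[ d ] 0# ≤ d × x + d ≈ y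
  ≤⇒gap {x} {y} x≤y = - x + y , +-cancelˡ-≤ x (≤-respˡ (sym (+-identityʳ x)) (≤-respʳ (sym eq) x≤y)) , eq
    where
    eq : x + (- x + y) ≈ y
    eq = trans (sym (+-assoc x (- x) y)) (trans (+-congʳ (-‿inverseʳ x)) (+-identityˡ y))

  *-monoˡ-≤ : ∀ {c x y} → 0# ≤ c → x ≤ y → c * x ≤ c * y
  *-monoˡ-≤ {c} {x} {y} 0≤c x≤y with ≤⇒gap x≤y
  ... | d , 0≤d , x+d≈y = begin
    c * x         ≤⟨ x≤x+y (c * x) (*-nonNegative 0≤c 0≤d) ⟩
    c * x + c * d ≈⟨ distribˡ c x d ⟨
    c * (x + d)   ≈⟨ *-congˡ x+d≈y ⟩
    c * y         ∎

  nonPositive⇒-nonNegative : ∀ {x} → x ≤ 0# → 0# ≤ - x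
  nonPositive⇒-nonNegative {x} x≤0 = +-cancelˡ-≤ x (≤-respˡ (sym (+-identityʳ x)) (≤-respʳ (sym (-‿inverseʳ x)) x≤0))

  0≤1 : 0# ≤ 1#
  0≤1 with ≤-total 0# 1#
  ... | inj₁ 0≤1 = 0≤1
  ... | inj₂ 1≤0 = ≤-respʳ eq (*-nonNegative 0≤-1 0≤-1)
    where
    0≤-1 : 0# ≤ - 1#
    0≤-1 = nonPositive⇒-nonNegative 1≤0
    eq : - 1# * - 1# ≈ 1#
    eq = trans (sym (-‿distribˡ-* 1# (- 1#))) (trans (-‿cong (*-identityˡ (- 1#))) (-‿involutive 1#))

  1≰0 : 1# ≤ 0# → ∀ {a} {A : Set a} → A
  1≰0 1≤0 = ⊥-elim (1≉0 (≤-antisym 1≤0 0≤1))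

  inverse-nonNegative : ∀ {x y} → 0# ≤ x → x * y ≈ 1# → 0# ≤ y
  inverse-nonNegative {x} {y} 0≤x xy≈1 with ≤-total 0# y
  ... | inj₁ 0≤y = 0≤y
  ... | inj₂ y≤0 = 1≰0 (begin
    1#    ≈⟨ xy≈1 ⟨
    x * y ≤⟨ *-monoˡ-≤ 0≤x y≤0 ⟩
    x * 0# ≈⟨ zeroʳ x ⟩
    0#    ∎)

  *-cancelˡ-nonZero : ∀ {x y z} → x ≉ 0# → x * y ≈ x * z → y ≈ z
  *-cancelˡ-nonZero {x} {y} {z} x≉0 xy≈xz with inverse x x≉0
  ... | x⁻¹ , xx⁻¹≈1 = trans (sym (undo y)) (trans (*-congˡ xy≈xz) (undo z))
    where
    undo : ∀ y → x⁻¹ * (x * y) ≈ y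
    undo y = trans (sym (*-assoc x⁻¹ x y)) (trans (*-congʳ (trans (*-comm x⁻¹ x) xx⁻¹≈1)) (*-identityˡ y))

  nonNegative-+≈0 : ∀ {x y} → 0# ≤ x → 0# ≤ y → x + y ≈ 0# → x ≈ 0#
  nonNegative-+≈0 {x} 0≤x 0≤y x+y≈0 = ≤-antisym (≤-respʳ x+y≈0 (x≤x+y x 0≤y)) 0≤x

  -- Divides 1 in the ratio v : w. If v + w vanishes then so do v and w, and any division works;
  -- `1#` and `0#` are taken.
  shares : ∀ {v w} → 0# ≤ v → 0# ≤ w →
           ∃[ s ] ∃[ t ] 0# ≤ s × 0# ≤ t × s + t ≈ 1# × s * (v + w) ≈ v × t * (v + w) ≈ w
  shares {v} {w} 0≤v 0≤w with (v + w) ≟ 0#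
  ... | yes v+w≈0 = 1# , 0# , 0≤1 , ≤-refl , +-identityʳ 1# , trans (*-identityˡ (v + w)) (trans v+w≈0 (sym v≈0))
                  , trans (zeroˡ (v + w)) (sym w≈0)
    where
    v≈0 : v ≈ 0#
    v≈0 = nonNegative-+≈0 0≤v 0≤w v+w≈0
    w≈0 : w ≈ 0#
    w≈0 = nonNegative-+≈0 0≤w 0≤v (trans (+-comm w v) v+w≈0)
  ... | no v+w≉0 with inverse (v + w) v+w≉0
  ...   | y , [v+w]y≈1 = v * y , w * y , *-nonNegative 0≤v 0≤y , *-nonNegative 0≤w 0≤y
                       , trans (sym (distribʳ y v w)) [v+w]y≈1 , undo v , undo w
    where
    0≤y : 0# ≤ y
    0≤y = inverse-nonNegative (+-nonNegative 0≤v 0≤w) [v+w]y≈1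
    undo : ∀ u → u * y * (v + w) ≈ u
    undo u = trans (*-assoc u y (v + w)) (trans (*-congˡ (trans (*-comm y (v + w)) [v+w]y≈1)) (*-identityʳ u))

  ×-nonNegative : ∀ r → 0# ≤ r ×ᴷ 1#
  ×-nonNegative 0         = ≤-refl
  ×-nonNegative (ℕ.suc r) = +-nonNegative 0≤1 (×-nonNegative r)

  sum-nonNegative : ∀ {n} {x : Vector Carrier n} → (∀ i → 0# ≤ x i) → 0# ≤ sum x
  sum-nonNegative {ℕ.zero}  0≤x = ≤-refl
  sum-nonNegative {ℕ.suc n} 0≤x = +-nonNegative (0≤x zero) (sum-nonNegative (λ i → 0≤x (suc i)))

-- Conic combinations with a prescribed total weight, and convex hulls.

module Cones (K : OrderedField) where

  open OrderedField K hiding (zero)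
  open Polytopes K
  open OrderedFieldProperties K
  open SemiringSum semiring using (∑-distrib-+; *-distribˡ-sum; sum-cong-≋; sum-replicate-zero)
  open ≤-Reasoning

  private variable
    n : ℕ
    A B : PointSet n
    w w′ : Carrier
    x x′ : Point n

  -- The index w is the total weight, so a cone of weight 1 is a convex combination.
  data Cone {n} (A : PointSet n) (w : Carrier) (x : Point n) : Set where
    nil  : w ≈ 0# → (∀ i → x i ≈ 0#) → Cone A w x
    cons : ∀ {p c w′ x′} → p ∈ A → 0# ≤ c → w ≈ c + w′ → x ≋ c · p ⊹ x′ → Cone A w′ x′ → Cone A w x

  cone-resp : w ≈ w′ → x ≋ x′ → Cone A w x → Cone A w′ x′
  cone-resp w≈ x≋ (nil w≈0 x≋0) = nil (trans (sym w≈) w≈0) (λ i → trans (sym (x≋ i)) (x≋0 i))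
  cone-resp w≈ x≋ (cons p∈A 0≤c w≈′ x≋′ t) = cons p∈A 0≤c (trans (sym w≈) w≈′) (λ i → trans (sym (x≋ i)) (x≋′ i)) t

  cone-point : x ∈ A → Cone A 1# x
  cone-point {x = x} x∈A = cons x∈A 0≤1 (sym (+-identityʳ 1#)) (λ i → sym (trans (+-identityʳ _) (*-identityˡ (x i))))
                          (nil {x = λ _ → 0#} refl (λ i → refl))

  cone-+ : Cone A w x → Cone A w′ x′ → Cone A (w + w′) (x ⊹ x′)
  cone-+ (nil w≈0 x≋0) u = cone-resp (sym (trans (+-congʳ w≈0) (+-identityˡ _)))
                                     (λ i → sym (trans (+-congʳ (x≋0 i)) (+-identityˡ _))) u
  cone-+ (cons p∈A 0≤c w≈ x≋ t) u = cons p∈A 0≤c (trans (+-congʳ w≈) (+-assoc _ _ _))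
                                         (λ i → trans (+-congʳ (x≋ i)) (+-assoc _ _ _)) (cone-+ t u)

  cone-* : ∀ {s} → 0# ≤ s → Cone A w x → Cone A (s * w) (s · x)
  cone-* {s = s} 0≤s (nil w≈0 x≋0) = nil (trans (*-congˡ w≈0) (zeroʳ s)) (λ i → trans (*-congˡ (x≋0 i)) (zeroʳ s))
  cone-* {s = s} 0≤s (cons {c = c} p∈A 0≤c w≈ x≋ t) =
    cons p∈A (*-nonNegative 0≤s 0≤c) (trans (*-congˡ w≈) (distribˡ s c _))
         (λ i → trans (*-congˡ (x≋ i)) (trans (distribˡ s _ _) (+-congʳ (sym (*-assoc s c _)))))
         (cone-* 0≤s t)

  -- Both pieces are multiples of x itself, in the ratio a : b, so the combination behind x need not
  -- be cut anywhere.
  cone-split : ∀ {a b} → 0# ≤ a → 0# ≤ b → Cone A (a + b) x →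
               ∃[ y ] ∃[ z ] Cone A a y × Cone A b z × x ≋ y ⊹ z
  cone-split {x = x} 0≤a 0≤b t with shares 0≤a 0≤b
  ... | s , u , 0≤s , 0≤u , s+u≈1 , s-share , u-share =
    s · x , u · x
    , cone-resp s-share (λ i → refl) (cone-* 0≤s t)
    , cone-resp u-share (λ i → refl) (cone-* 0≤u t)
    , λ i → sym (trans (sym (distribʳ (x i) s u)) (trans (*-congʳ s+u≈1) (*-identityˡ (x i))))

  -- Every generator receives the same new entry e, so the combination receives e times the total
  -- weight.
  cone-∷ : ∀ e → (∀ {p} → p ∈ A → e ∷ p ∈ B) → Cone A w x → Cone B w (w * e ∷ x)
  cone-∷ e A⇒B (nil w≈0 x≋0) = nil w≈0 λ where
    zero    → trans (*-congʳ w≈0) (zeroˡ e)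
    (suc i) → x≋0 i
  cone-∷ e A⇒B (cons {c = c} p∈A 0≤c w≈ x≋ t) = cons (A⇒B p∈A) 0≤c w≈
    (λ where
      zero    → trans (*-congʳ w≈) (distribʳ e c _)
      (suc i) → x≋ i)
    (cone-∷ e A⇒B t)

  cone-nonNegative : (∀ {p} → p ∈ A → ∀ i → 0# ≤ p i) → Cone A w x → ∀ i → 0# ≤ x i
  cone-nonNegative 0≤A (nil w≈0 x≋0) i = ≤-reflexive (sym (x≋0 i))
  cone-nonNegative 0≤A (cons p∈A 0≤c w≈ x≋ t) i =
    ≤-respʳ (sym (x≋ i)) (+-nonNegative (*-nonNegative 0≤c (0≤A p∈A i)) (cone-nonNegative 0≤A t i))

  cone-≤weight : (∀ {p} → p ∈ A → ∀ i → p i ≤ 1#) → Cone A w x → ∀ i → x i ≤ w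
  cone-≤weight A≤1 (nil w≈0 x≋0) i = ≤-reflexive (trans (x≋0 i) (sym w≈0))
  cone-≤weight {w = w} {x = x} A≤1 (cons {p} {c} {w′} {x′} p∈A 0≤c w≈ x≋ t) i = begin
    x i            ≈⟨ x≋ i ⟩
    c * p i + x′ i ≤⟨ +-mono-≤ (*-monoˡ-≤ 0≤c (A≤1 p∈A i)) (cone-≤weight A≤1 t i) ⟩
    c * 1# + w′    ≈⟨ +-congʳ (*-identityʳ c) ⟩
    c + w′         ≈⟨ w≈ ⟨
    w              ∎

  cone-sum : ∀ {n} {A : PointSet n} {w x h} → (∀ {p} → p ∈ A → sum p ≈ h) → Cone A w x → sum x ≈ w * h
  cone-sum {n} {w = w} {x} {h} A-sum (nil w≈0 x≋0) = begin-equality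
    sum x            ≈⟨ sum-cong-≋ x≋0 ⟩
    sum {n} (λ _ → 0#) ≈⟨ sum-replicate-zero n ⟩
    0#               ≈⟨ zeroˡ h ⟨
    0# * h           ≈⟨ *-congʳ w≈0 ⟨
    w * h            ∎
  cone-sum {w = w} {x} {h} A-sum (cons {p} {c} {w′} {x′} p∈A 0≤c w≈ x≋ t) = begin-equality
    sum x                ≈⟨ sum-cong-≋ x≋ ⟩
    sum (c · p ⊹ x′)     ≈⟨ ∑-distrib-+ (c · p) x′ ⟩
    sum (c · p) + sum x′ ≈⟨ +-congʳ (*-distribˡ-sum c p) ⟨
    c * sum p + sum x′   ≈⟨ +-cong (*-congˡ (A-sum p∈A)) (cone-sum A-sum t) ⟩
    c * h + w′ * h       ≈⟨ distribʳ h c w′ ⟨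
    (c + w′) * h         ≈⟨ *-congʳ w≈ ⟨
    w * h                ∎

  cone-∑ : ∀ {m} (p : Vector (Point n) m) (w : Vector Carrier m) → (∀ j → Cone A 1# (p j)) → (∀ j → 0# ≤ w j) →
           Cone A (sum w) (λ i → sum (λ j → w j * p j i))
  cone-∑ {m = ℕ.zero}  p w p∈ 0≤w = nil refl (λ i → refl)
  cone-∑ {m = ℕ.suc m} p w p∈ 0≤w =
    cone-+ (cone-resp (*-identityʳ (w zero)) (λ i → refl) (cone-* (0≤w zero) (p∈ zero)))
           (cone-∑ (tail p) (tail w) (λ j → p∈ (suc j)) (λ j → 0≤w (suc j)))

  -- Flattens a combination of combinations. With `cone-point` it turns hulls into cones; with
  -- generators that are themselves in a hull it gives idempotence of the hull.
  hull-of-cones : (∀ {p} → p ∈ A → Cone B 1# p) → ConvexHull A x → Cone B 1# x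
  hull-of-cones A⇒B (m , p , w , p∈A , 0≤w , ∑w≈1 , x≋) =
    cone-resp ∑w≈1 (λ i → sym (x≋ i)) (cone-∑ p w (λ j → A⇒B (p∈A j)) 0≤w)

  hull⇒cone : ConvexHull A x → Cone A 1# x
  hull⇒cone = hull-of-cones cone-point

  cone⇒hull : Cone A 1# x → ConvexHull A x
  cone⇒hull = weighted
    where
    -- Total weight 1 is not inherited by the tail of a cone, so the recursion runs over all
    -- weights.
    weighted : Cone A w x → ∃[ m ] Σ[ p ∈ Vector (Point _) m ] Σ[ u ∈ Vector Carrier m ]
               (∀ j → p j ∈ A) × (∀ j → 0# ≤ u j) × sum u ≈ w × (∀ i → x i ≈ sum (λ j → u j * p j i))
    weighted (nil w≈0 x≋0) = 0 , [] , [] , (λ ()) , (λ ()) , sym w≈0 , x≋0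
    weighted (cons {p = p} {c} p∈A 0≤c w≈ x≋ t) with weighted t
    ... | m , ps , u , ps∈A , 0≤u , ∑u≈ , x′≋ =
      ℕ.suc m , p ∷ ps , c ∷ u
      , (λ { zero → p∈A ; (suc j) → ps∈A j })
      , (λ { zero → 0≤c ; (suc j) → 0≤u j })
      , trans (+-congˡ ∑u≈) (sym w≈)
      , (λ i → trans (x≋ i) (+-congˡ (x′≋ i)))

  polytope-convex : IsPolytope A → ConvexHull A ⊆ A
  polytope-convex (m , p , A⊆hull , hull⊆A) x∈hull =
    hull⊆A (cone⇒hull (hull-of-cones (λ p∈A → hull⇒cone {A = λ x → ∃[ j ] x ≋ p j} (A⊆hull p∈A)) x∈hull))

-- Hypersimplices as slices of the unit cube.

module Hypersimplices (K : OrderedField) where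

  open OrderedField K hiding (zero)
  open Polytopes K
  open OrderedFieldProperties K
  open Cones K
  open SemiringSum semiring using (*-distribˡ-sum; sum-cong-≋)
  open ≤-Reasoning

  Vertices : ∀ n → ℕ → PointSet n
  Vertices n r x = IsCubeVertex x × sum x ≈ r ×ᴷ 1#

  module _ {n r : ℕ} {w : Carrier} {x : Point n} (t : Cone (Vertices n r) w x) where

    vertexCone-nonNegative : ∀ i → 0# ≤ x i
    vertexCone-nonNegative = cone-nonNegative 0≤V t
      where
      0≤V : ∀ {p} → p ∈ Vertices n r → ∀ i → 0# ≤ p i
      0≤V p∈V i with proj₁ p∈V i
      ... | inj₁ pi≈0 = ≤-reflexive (sym pi≈0)
      ... | inj₂ pi≈1 = ≤-respʳ (sym pi≈1) 0≤1

    vertexCone-≤weight : ∀ i → x i ≤ w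
    vertexCone-≤weight = cone-≤weight V≤1 t
      where
      V≤1 : ∀ {p} → p ∈ Vertices n r → ∀ i → p i ≤ 1#
      V≤1 p∈V i with proj₁ p∈V i
      ... | inj₁ pi≈0 = ≤-respˡ (sym pi≈0) 0≤1
      ... | inj₂ pi≈1 = ≤-reflexive pi≈1

  module _ {n : ℕ} (r : ℕ) {p : Point n} (p∈V : p ∈ Vertices n r) where

    0∷-vertex : (0# ∷ p) ∈ Vertices (ℕ.suc n) r
    0∷-vertex = (λ { zero → inj₁ refl ; (suc i) → proj₁ p∈V i }) , trans (+-identityˡ (sum p)) (proj₂ p∈V)

    1∷-vertex : (1# ∷ p) ∈ Vertices (ℕ.suc n) (ℕ.suc r)
    1∷-vertex = (λ { zero → inj₂ refl ; (suc i) → proj₁ p∈V i }) , +-congˡ (proj₂ p∈V)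

  module _ {n : ℕ} (r : ℕ) {w : Carrier} {x : Point n} where

    cone-0∷ : Cone (Vertices n r) w x → Cone (Vertices (ℕ.suc n) r) w (0# ∷ x)
    cone-0∷ t = cone-resp refl (λ { zero → zeroʳ w ; (suc i) → refl }) (cone-∷ 0# (0∷-vertex r) t)

    -- Lifting weight w by one level costs exactly w in the new coordinate. This is the exchange
    -- rate behind `raise-lower-level` and `raise-upper-level`.
    cone-1∷ : Cone (Vertices n r) w x → Cone (Vertices (ℕ.suc n) (ℕ.suc r)) w (w ∷ x)
    cone-1∷ t = cone-resp refl (λ { zero → *-identityʳ w ; (suc i) → refl }) (cone-∷ 1# (1∷-vertex r) t)

  InCube : ∀ {n} → PointSet n
  InCube x = ∀ i → 0# ≤ x i × x i ≤ 1#

  -- Weight a on vertices of level r and weight b on vertices of level r + 1. If a + b = 1, the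
  -- coordinate sum is r + b.
  BetweenLevels : ∀ {n} → ℕ → Carrier → Carrier → PointSet n
  BetweenLevels {n} r a b x =
    ∃[ y ] ∃[ z ] Cone (Vertices n r) a y × Cone (Vertices n (ℕ.suc r)) b z × x ≋ y ⊹ z

  private
    module _ {n : ℕ} {x : Point (ℕ.suc n)} {a b : Carrier} (0≤a : 0# ≤ a) (0≤b : 0# ≤ b) (a+b≈1 : a + b ≈ 1#) where

      -- Of the weight a + `head x` at level r, the part `head x` gets a leading 1 and joins level r
      -- + 1. All other weight gets a leading 0.
      raise-lower-level : ∀ r {b′} → head x + b′ ≈ b → 0# ≤ head x →
                          BetweenLevels r (a + head x) b′ (tail x) → BetweenLevels r a b x
      raise-lower-level r {b′} x₀+b′≈b 0≤x₀ (y , z , ty , tz , x≋) with cone-split 0≤a 0≤x₀ ty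
      ... | y₁ , y₂ , ty₁ , ty₂ , y≋ =
        (0# ∷ y₁) , (head x ∷ y₂) ⊹ (0# ∷ z)
        , cone-0∷ r ty₁
        , cone-resp x₀+b′≈b (λ i → refl) (cone-+ (cone-1∷ r ty₂) (cone-0∷ (ℕ.suc r) tz))
        , λ where
            zero    → solve 1 (λ u → u := con 0 :+ (u :+ con 0)) refl (head x)
            (suc i) → trans (x≋ i) (trans (+-congʳ (y≋ i)) (+-assoc (y₁ i) (y₂ i) (z i)))

      -- The tail uses levels r and r + 1, the result levels r + 1 and r + 2. So all weight a′ of
      -- the lower level gets a leading 1, as does the part b of the upper level; the part d gets a
      -- leading 0 and stays at level r + 1.
      raise-upper-level : ∀ r {a′ d} → 0# ≤ d → head x ≈ a′ + b → head x + d ≈ 1# →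
                          BetweenLevels r a′ (b + d) (tail x) → BetweenLevels (ℕ.suc r) a b x
      raise-upper-level r {a′} {d} 0≤d x₀≈a′+b x₀+d≈1 (y , z , ty , tz , x≋) with cone-split 0≤b 0≤d tz
      ... | z₁ , z₂ , tz₁ , tz₂ , z≋ =
        (a′ ∷ y) ⊹ (0# ∷ z₂) , (b ∷ z₁)
        , cone-resp a′+d≈a (λ i → refl) (cone-+ (cone-1∷ r ty) (cone-0∷ (ℕ.suc r) tz₂))
        , cone-1∷ (ℕ.suc r) tz₁
        , λ where
            zero    → trans x₀≈a′+b (+-congʳ (sym (+-identityʳ a′)))
            (suc i) → trans (x≋ i) (trans (+-congˡ (z≋ i))
                        (solve 3 (λ u v w → u :+ (v :+ w) := u :+ w :+ v) refl (y i) (z₁ i) (z₂ i)))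
        where
        a′+d≈a : a′ + d ≈ a
        a′+d≈a = +-cancelʳ b _ _ (begin-equality
          a′ + d + b ≈⟨ solve 3 (λ u v w → u :+ v :+ w := u :+ w :+ v) refl a′ d b ⟩
          a′ + b + d ≈⟨ +-congʳ x₀≈a′+b ⟨
          head x + d ≈⟨ x₀+d≈1 ⟩
          1#         ≈⟨ a+b≈1 ⟨
          a + b      ∎)

  -- Levels r and r + 1 together make the induction on n close without taking integer parts:
  -- raising the first coordinate of some of the weight moves it up by one level.
  between-levels : ∀ {n} r {x : Point n} {a b} → x ∈ InCube → 0# ≤ a → 0# ≤ b → a + b ≈ 1# →
                   sum x ≈ r ×ᴷ 1# + b → BetweenLevels r a b x
  between-levels {ℕ.zero} ℕ.zero {x} {a} {b} x∈I 0≤a 0≤b a+b≈1 ∑x≈ =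
    -- In dimension 0 the sum is 0, so b = 0 and all weight rests on the empty vector, the vertex of
    -- level 0.
    x , x , cone-resp {x = x} 1≈a (λ ()) (cone-point {A = Vertices 0 0} ((λ ()) , refl)) , nil b≈0 (λ ()) , λ ()
    where
    b≈0 : b ≈ 0#
    b≈0 = sym (trans ∑x≈ (+-identityˡ b))
    1≈a : 1# ≈ a
    1≈a = trans (sym a+b≈1) (trans (+-congˡ b≈0) (+-identityʳ a))
  between-levels {ℕ.zero} (ℕ.suc r) {b = b} x∈I 0≤a 0≤b a+b≈1 ∑x≈ = 1≰0 (begin
    1#                  ≤⟨ x≤x+y 1# (+-nonNegative (×-nonNegative r) 0≤b) ⟩
    1# + (r ×ᴷ 1# + b)  ≈⟨ +-assoc 1# (r ×ᴷ 1#) b ⟨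
    1# + r ×ᴷ 1# + b    ≈⟨ ∑x≈ ⟨
    0#                  ∎)
  between-levels {ℕ.suc n} r {x} {a} {b} x∈I 0≤a 0≤b a+b≈1 ∑x≈ = by-tail r ∑x≈ (compare r)
    where
    x₀ t : Carrier
    x₀ = head x
    t  = sum (tail x)

    tail∈I : tail x ∈ InCube
    tail∈I i = x∈I (suc i)

    -- Decides whether the tail is handled at levels r, r + 1 or at levels r - 1, r. The second case
    -- records that r is a successor, so that a level below exists.
    compare : ∀ r → r ×ᴷ 1# ≤ t ⊎ (∃[ r′ ] r ≡ ℕ.suc r′ × t ≤ r ×ᴷ 1#)
    compare ℕ.zero = inj₁ (sum-nonNegative (λ i → proj₁ (tail∈I i)))
    compare (ℕ.suc r) with ≤-total (ℕ.suc r ×ᴷ 1#) t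
    ... | inj₁ r≤t = inj₁ r≤t
    ... | inj₂ t≤r = inj₂ (r , ≡.refl , t≤r)

    by-tail : ∀ r → x₀ + t ≈ r ×ᴷ 1# + b → r ×ᴷ 1# ≤ t ⊎ (∃[ r′ ] r ≡ ℕ.suc r′ × t ≤ r ×ᴷ 1#) →
              BetweenLevels r a b x
    -- The tail has sum r + b′, hence upper weight b′. As b′ = b - x₀, its lower weight is a + x₀.
    by-tail r ∑x≈ (inj₁ r≤t) with ≤⇒gap r≤t
    ... | b′ , 0≤b′ , r+b′≈t =
      raise-lower-level 0≤a 0≤b a+b≈1 r x₀+b′≈b (proj₁ (x∈I zero))
        (between-levels r tail∈I (+-nonNegative 0≤a (proj₁ (x∈I zero))) 0≤b′
          (trans (+-assoc a x₀ b′) (trans (+-congˡ x₀+b′≈b) a+b≈1)) (sym r+b′≈t))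
      where
      x₀+b′≈b : x₀ + b′ ≈ b
      x₀+b′≈b = +-cancelˡ (r ×ᴷ 1#) _ _ (begin-equality
        r ×ᴷ 1# + (x₀ + b′) ≈⟨ solve 3 (λ u v w → u :+ (v :+ w) := v :+ (u :+ w)) refl (r ×ᴷ 1#) x₀ b′ ⟩
        x₀ + (r ×ᴷ 1# + b′) ≈⟨ +-congˡ r+b′≈t ⟩
        x₀ + t              ≈⟨ ∑x≈ ⟩
        r ×ᴷ 1# + b         ∎)
    -- The tail has sum 1 + r - a′, hence lower weight a′. With d = 1 - x₀ its upper weight 1 - a′
    -- equals b + d.
    by-tail (ℕ.suc r) ∑x≈ (inj₂ (_ , _ , t≤1+r)) with ≤⇒gap t≤1+r | ≤⇒gap (proj₂ (x∈I zero))
    ... | a′ , 0≤a′ , t+a′≈1+r | d , 0≤d , x₀+d≈1 =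
      raise-upper-level 0≤a 0≤b a+b≈1 r 0≤d x₀≈a′+b x₀+d≈1
        (between-levels r tail∈I 0≤a′ (+-nonNegative 0≤b 0≤d) a′+[b+d]≈1
          (+-cancelʳ a′ _ _ (begin-equality
            t + a′                     ≈⟨ t+a′≈1+r ⟩
            1# + r ×ᴷ 1#               ≈⟨ +-congʳ a′+[b+d]≈1 ⟨
            a′ + (b + d) + r ×ᴷ 1#     ≈⟨ solve 3 (λ u v w → u :+ v :+ w := w :+ v :+ u) refl a′ (b + d) (r ×ᴷ 1#) ⟩
            r ×ᴷ 1# + (b + d) + a′     ∎)))
      where
      x₀≈a′+b : x₀ ≈ a′ + b
      x₀≈a′+b = +-cancelʳ t _ _ (begin-equality
        x₀ + t               ≈⟨ ∑x≈ ⟩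
        1# + r ×ᴷ 1# + b     ≈⟨ +-congʳ t+a′≈1+r ⟨
        t + a′ + b           ≈⟨ solve 3 (λ u v w → u :+ v :+ w := v :+ w :+ u) refl t a′ b ⟩
        a′ + b + t           ∎)
      a′+[b+d]≈1 : a′ + (b + d) ≈ 1#
      a′+[b+d]≈1 = trans (sym (+-assoc a′ b d)) (trans (+-congʳ (sym x₀≈a′+b)) x₀+d≈1)

  module _ {n r : ℕ} {x : Point n} where

    hypersimplex-inCube : x ∈ hypersimplex n r → x ∈ InCube
    hypersimplex-inCube x∈Δ i = vertexCone-nonNegative {r = r} t i , vertexCone-≤weight {r = r} t i
      where t = hull⇒cone {A = Vertices n r} x∈Δ

    hypersimplex-sum : x ∈ hypersimplex n r → sum x ≈ r ×ᴷ 1#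
    hypersimplex-sum x∈Δ = trans (cone-sum proj₂ (hull⇒cone {A = Vertices n r} x∈Δ)) (*-identityˡ _)

    -- The case a = 1, b = 0 of `between-levels`: the upper part has weight 0, which squeezes its
    -- coordinates between 0 and 0.
    cube∧sum⇒hypersimplex : x ∈ InCube → sum x ≈ r ×ᴷ 1# → x ∈ hypersimplex n r
    cube∧sum⇒hypersimplex x∈I ∑x≈ with between-levels r x∈I 0≤1 ≤-refl (+-identityʳ 1#) (trans ∑x≈ (sym (+-identityʳ _)))
    ... | y , z , ty , tz , x≋ =
      cone⇒hull (cone-resp refl (λ i → sym (trans (x≋ i) (trans (+-congˡ (z≈0 i)) (+-identityʳ (y i))))) ty)
      where
      z≈0 : ∀ i → z i ≈ 0#
      z≈0 i = ≤-antisym (vertexCone-≤weight {r = ℕ.suc r} tz i) (vertexCone-nonNegative {r = ℕ.suc r} tz i)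

  ⊙-hypersimplex : ∀ {n r μ} {e x : Point n} → 0# ≤ μ → e ∈ Vertices n r → (∀ i → 0# ≤ x i × x i ≤ μ) →
                   sum x ≈ μ * (r ×ᴷ 1#) → x ∈ μ ⊙ hypersimplex n r
  ⊙-hypersimplex {n} {r} {μ} {e} {x} 0≤μ e∈V 0≤x≤μ ∑x≈ with μ ≟ 0#
  -- Here x is the origin, and `e` serves as a point of the hypersimplex to be scaled by 0.
  ... | yes μ≈0 = e , cone⇒hull {A = Vertices n r} (cone-point e∈V) , λ i →
    trans (≤-antisym (≤-respʳ μ≈0 (proj₂ (0≤x≤μ i))) (proj₁ (0≤x≤μ i))) (sym (trans (*-congʳ μ≈0) (zeroˡ (e i))))
  ... | no μ≉0 = p , cube∧sum⇒hypersimplex {r = r} p∈I (*-cancelˡ-nonZero μ≉0 μ∑p≈) , x≋μp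
    where
    -- Division of x i by μ: s is the share of x i in x i + d = μ, and the complementary share shows
    -- s ≤ 1.
    scaled : ∀ i → ∃[ s ] (0# ≤ s × s ≤ 1#) × x i ≈ μ * s
    scaled i with ≤⇒gap (proj₂ (0≤x≤μ i))
    ... | d , 0≤d , x+d≈μ with shares (proj₁ (0≤x≤μ i)) 0≤d
    ...   | s , u , 0≤s , 0≤u , s+u≈1 , s[x+d]≈x , _ =
      s , (0≤s , ≤-respʳ s+u≈1 (x≤x+y s 0≤u)) , trans (sym s[x+d]≈x) (trans (*-congˡ x+d≈μ) (*-comm s μ))
    p : Point n
    p i = proj₁ (scaled i)
    p∈I : p ∈ InCube
    p∈I i = proj₁ (proj₂ (scaled i))
    x≋μp : x ≋ μ · p
    x≋μp i = proj₂ (proj₂ (scaled i))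
    μ∑p≈ : μ * sum p ≈ μ * (r ×ᴷ 1#)
    μ∑p≈ = trans (*-distribˡ-sum μ p) (trans (sum-cong-≋ (λ i → sym (x≋μp i))) ∑x≈)

-- Minkowski summands of a hypersimplex.

module MinkowskiSummands (K : OrderedField) where

  open OrderedField K hiding (zero)
  open Polytopes K
  open OrderedFieldProperties K
  open Cones K
  open Hypersimplices K
  open SemiringSum semiring using (∑-distrib-+; *-distribˡ-sum; sum-cong-≋; sum-remove)
  open ≤-Reasoning

  Vertex : ℕ → ℕ → Set
  Vertex n r = Σ[ e ∈ Point n ] e ∈ Vertices n r

  -- Carries an affine map through a weighted sum. Keeping `sum w` general lets the induction pass
  -- to tails; it is set to 1 in `Q⊇`.
  ∑-affine : ∀ {m} a μ (w y : Vector Carrier m) →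
             sum (λ j → w j * (a + μ * y j)) ≈ sum w * a + μ * sum (λ j → w j * y j)
  ∑-affine {ℕ.zero}  a μ w y = sym (trans (+-cong (zeroˡ a) (zeroʳ μ)) (+-identityʳ 0#))
  ∑-affine {ℕ.suc m} a μ w y = trans (+-congˡ (∑-affine a μ (tail w) (tail y)))
    (solve 6 (λ a μ w y W Y → w :* (a :+ μ :* y) :+ (W :* a :+ μ :* Y) := (w :+ W) :* a :+ μ :* (w :* y :+ Y)) refl
      a μ (head w) (head y) (sum (tail w)) (sum (λ j → tail w j * tail y j)))

  insertAt-cubeVertex : ∀ {n} {x : Point n} {v} j → v ≈ 0# ⊎ v ≈ 1# → IsCubeVertex x → IsCubeVertex (insertAt x j v)
  insertAt-cubeVertex               zero    v∈01 x∈01 zero    = v∈01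
  insertAt-cubeVertex               zero    v∈01 x∈01 (suc i) = x∈01 i
  insertAt-cubeVertex {n = ℕ.suc n} (suc j) v∈01 x∈01 zero    = x∈01 zero
  insertAt-cubeVertex {n = ℕ.suc n} {x} (suc j) v∈01 x∈01 (suc i) =
    insertAt-cubeVertex {x = tail x} j v∈01 (λ i → x∈01 (suc i)) i

  sum-insertAt : ∀ {n} (x : Point n) j v → sum (insertAt x j v) ≈ v + sum x
  sum-insertAt x j v = trans (sum-remove {i = j} (insertAt x j v))
    (+-cong (reflexive (insertAt-lookup x j v)) (sum-cong-≋ (λ i → reflexive (removeAt-insertAt x j v i))))

  some-vertex : ∀ {n r} → r ℕ.≤ n → Vertex n r
  some-vertex {ℕ.zero}  {ℕ.zero}  r≤n = [] , (λ ()) , refl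
  some-vertex {ℕ.suc n} {ℕ.zero}  r≤n = _ , 0∷-vertex 0 (proj₂ (some-vertex {n} ℕ.z≤n))
  some-vertex {ℕ.suc n} {ℕ.suc r} (ℕ.s≤s r≤n) = _ , 1∷-vertex r (proj₂ (some-vertex r≤n))

  module Summand {n r : ℕ} {c : Carrier} {Q R : PointSet n} (0≤c : 0# ≤ c)
                 (cΔ⊆Q+R : c ⊙ hypersimplex n r ⊆ Q ⊕ R) (Q+R⊆cΔ : Q ⊕ R ⊆ c ⊙ hypersimplex n r) where

    split-vertex : ((e , _) : Vertex n r) → c · e ∈ Q ⊕ R
    split-vertex (e , e∈V) = cΔ⊆Q+R (e , cone⇒hull {A = Vertices n r} (cone-point e∈V) , λ i → refl)

    -- The points q_e and s_e of the overview, read off a chosen decomposition of c e. The choice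
    -- may depend on the proof that e is a vertex; `apex-cong` shows that this does not affect
    -- coordinates of `apex`.
    apex coapex : Vertex n r → Point n
    apex   e = proj₁ (split-vertex e)
    coapex e = proj₁ (proj₂ (split-vertex e))

    apex∈Q : ∀ e → apex e ∈ Q
    apex∈Q e = proj₁ (proj₂ (proj₂ (split-vertex e)))

    coapex∈R : ∀ e → coapex e ∈ R
    coapex∈R e = proj₁ (proj₂ (proj₂ (proj₂ (split-vertex e))))

    apex+coapex : ∀ e → c · proj₁ e ≋ apex e ⊹ coapex e
    apex+coapex e = proj₂ (proj₂ (proj₂ (proj₂ (split-vertex e))))

    +-inCube : ∀ {q s} → q ∈ Q → s ∈ R → ∀ i → 0# ≤ q i + s i × q i + s i ≤ c
    +-inCube {q} {s} q∈Q s∈R i with Q+R⊆cΔ (q , s , q∈Q , s∈R , λ i → refl)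
    ... | p , p∈Δ , q+s≋cp with hypersimplex-inCube {r = r} p∈Δ i
    ...   | 0≤p , p≤1 = ≤-respʳ (sym (q+s≋cp i)) (*-nonNegative 0≤c 0≤p)
                      , ≤-respˡ (sym (q+s≋cp i)) (≤-respʳ (*-identityʳ c) (*-monoˡ-≤ 0≤c p≤1))

    sum-+ : ∀ {q s} → q ∈ Q → s ∈ R → sum q + sum s ≈ c * (r ×ᴷ 1#)
    sum-+ {q} {s} q∈Q s∈R with Q+R⊆cΔ (q , s , q∈Q , s∈R , λ i → refl)
    ... | p , p∈Δ , q+s≋cp = begin-equality
      sum q + sum s  ≈⟨ ∑-distrib-+ q s ⟨
      sum (q ⊹ s)    ≈⟨ sum-cong-≋ q+s≋cp ⟩
      sum (c · p)    ≈⟨ *-distribˡ-sum c p ⟨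
      c * sum p      ≈⟨ *-congˡ (hypersimplex-sum {r = r} p∈Δ) ⟩
      c * (r ×ᴷ 1#)  ∎

    -- Adding the same `coapex e` to q and to `apex e` lands both in cΔ, where the coordinate sum is
    -- fixed.
    sum-constant : ∀ {q} e → q ∈ Q → sum q ≈ sum (apex e)
    sum-constant e q∈Q = +-cancelʳ (sum (coapex e)) _ _
      (trans (sum-+ q∈Q (coapex∈R e)) (sym (sum-+ (apex∈Q e) (coapex∈R e))))

    -- With the common summand `coapex e`, the apex attains the bound c at coordinate i, and q
    -- cannot exceed it. `apex-minimal` is the mirror image at the bound 0.
    apex-maximal : ∀ {q} e {i} → q ∈ Q → proj₁ e i ≈ 1# → q i ≤ apex e i
    apex-maximal {q} e {i} q∈Q ei≈1 = +-cancelʳ-≤ (coapex e i) (begin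
      q i + coapex e i      ≤⟨ proj₂ (+-inCube q∈Q (coapex∈R e) i) ⟩
      c                     ≈⟨ *-identityʳ c ⟨
      c * 1#                ≈⟨ *-congˡ ei≈1 ⟨
      c * proj₁ e i         ≈⟨ apex+coapex e i ⟩
      apex e i + coapex e i ∎)

    apex-minimal : ∀ {q} e {i} → q ∈ Q → proj₁ e i ≈ 0# → apex e i ≤ q i
    apex-minimal {q} e {i} q∈Q ei≈0 = +-cancelʳ-≤ (coapex e i) (begin
      apex e i + coapex e i ≈⟨ apex+coapex e i ⟨
      c * proj₁ e i         ≈⟨ *-congˡ ei≈0 ⟩
      c * 0#                ≈⟨ zeroʳ c ⟩
      0#                    ≤⟨ proj₁ (+-inCube q∈Q (coapex∈R e) i) ⟩
      q i + coapex e i      ∎)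

    -- Two minimisers, or two maximisers, of the same coordinate over Q agree in that coordinate.
    apex-cong : ∀ e e′ {i} → proj₁ e i ≈ proj₁ e′ i → apex e i ≈ apex e′ i
    apex-cong e e′ {i} ei≈e′i with proj₁ (proj₂ e) i
    ... | inj₁ ei≈0 = ≤-antisym (apex-minimal e (apex∈Q e′) ei≈0)
                                (apex-minimal e′ (apex∈Q e) (trans (sym ei≈e′i) ei≈0))
    ... | inj₂ ei≈1 = ≤-antisym (apex-maximal e′ (apex∈Q e) (trans (sym ei≈e′i) ei≈1))
                                (apex-maximal e (apex∈Q e′) ei≈1)

  -- Homothety of a summand when the level lies strictly between 0 and the dimension.

  module _ {m r : ℕ} (r≤m : r ℕ.≤ m) {c : Carrier} {Q R : PointSet (2 ℕ.+ m)} (0≤c : 0# ≤ c)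
           (convexQ : ConvexHull Q ⊆ Q)
           (cΔ⊆Q+R : c ⊙ hypersimplex (2 ℕ.+ m) (ℕ.suc r) ⊆ Q ⊕ R)
           (Q+R⊆cΔ : Q ⊕ R ⊆ c ⊙ hypersimplex (2 ℕ.+ m) (ℕ.suc r)) where

    open Summand {r = ℕ.suc r} 0≤c cΔ⊆Q+R Q+R⊆cΔ

    private
      n : ℕ
      n = 2 ℕ.+ m

      base : Vertex m r
      base = some-vertex r≤m

      -- A pair of vertices that differ only by swapping a 1 between coordinates 0 and 1 + j; the
      -- other m coordinates are those of `base`.
      1-0-at 0-1-at : Fin (ℕ.suc m) → Vertex n (ℕ.suc r)
      1-0-at j = 1# ∷ insertAt (proj₁ base) j 0#
               , 1∷-vertex r ( insertAt-cubeVertex {x = proj₁ base} j (inj₁ refl) (proj₁ (proj₂ base))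
                             , trans (sum-insertAt (proj₁ base) j 0#) (trans (+-identityˡ _) (proj₂ (proj₂ base))))
      0-1-at j = 0# ∷ insertAt (proj₁ base) j 1#
               , 0∷-vertex (ℕ.suc r) ( insertAt-cubeVertex {x = proj₁ base} j (inj₂ refl) (proj₁ (proj₂ base))
                                     , trans (sum-insertAt (proj₁ base) j 1#) (+-congˡ (proj₂ (proj₂ base))))

      -- For coordinate 0 any partner would do; coordinate 1 is the default.
      containing avoiding : Fin n → Vertex n (ℕ.suc r)
      containing zero    = 1-0-at zero
      containing (suc j) = 0-1-at j
      avoiding   zero    = 0-1-at zero
      avoiding   (suc j) = 1-0-at j

      containing-1 : ∀ i → proj₁ (containing i) i ≈ 1#
      containing-1 zero    = refl
      containing-1 (suc j) = reflexive (insertAt-lookup (proj₁ base) j 1#)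

      avoiding-0 : ∀ i → proj₁ (avoiding i) i ≈ 0#
      avoiding-0 zero    = refl
      avoiding-0 (suc j) = reflexive (insertAt-lookup (proj₁ base) j 0#)

      -- The corners of the bounding box of Q: `lower` is the vector m of the overview, and `upper`
      -- is m + λ.
      upper lower : Point n
      upper i = apex (containing i) i
      lower i = apex (avoiding i) i

      lower-≤ : ∀ {q} → q ∈ Q → ∀ i → lower i ≤ q i
      lower-≤ q∈Q i = apex-minimal (avoiding i) q∈Q (avoiding-0 i)

      ≤-upper : ∀ {q} → q ∈ Q → ∀ i → q i ≤ upper i
      ≤-upper q∈Q i = apex-maximal (containing i) q∈Q (containing-1 i)

      -- The two apices agree off the coordinates 0 and 1 + j and have the same coordinate sum.
      exchange : ∀ j → upper zero + lower (suc j) ≈ lower zero + upper (suc j)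
      exchange j = +-cancelʳ (sum (rest e)) _ _ (begin-equality
        -- Only the terms at coordinate 0 need `apex-cong`; `lower (suc j)` and `upper (suc j)` are
        -- by definition coordinates of `apex e` and `apex e′`.
        upper zero + lower (suc j) + sum (rest e)  ≈⟨ +-congʳ (+-congʳ (apex-cong (containing zero) e refl)) ⟩
        apex e zero + lower (suc j) + sum (rest e) ≈⟨ expand e ⟨
        sum (apex e)                               ≈⟨ sum-constant e′ (apex∈Q e) ⟩
        sum (apex e′)                              ≈⟨ expand e′ ⟩
        apex e′ zero + upper (suc j) + sum (rest e′)
          ≈⟨ +-cong (+-congʳ (apex-cong e′ (avoiding zero) refl)) (sum-cong-≋ rest-agree) ⟩
        lower zero + upper (suc j) + sum (rest e)  ∎)
        where
        e e′ : Vertex n (ℕ.suc r)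
        e  = 1-0-at j
        e′ = 0-1-at j
        rest : Vertex n (ℕ.suc r) → Point m
        rest v = removeAt (tail (apex v)) j
        expand : ∀ v → sum (apex v) ≈ apex v zero + apex v (suc j) + sum (rest v)
        expand v = trans (+-congˡ (sum-remove {i = j} (tail (apex v)))) (sym (+-assoc _ _ _))
        rest-agree : rest e′ ≋ rest e
        rest-agree i = apex-cong e′ e (reflexive
          (≡.trans (insertAt-punchIn (proj₁ base) j 1# i) (≡.sym (insertAt-punchIn (proj₁ base) j 0# i))))

      width : ∃[ μ ] 0# ≤ μ × lower zero + μ ≈ upper zero
      width = ≤⇒gap (lower-≤ (apex∈Q (containing zero)) zero)

      μ : Carrier
      μ = proj₁ width

      0≤μ : 0# ≤ μ
      0≤μ = proj₁ (proj₂ width)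

      -- The width μ is measured at coordinate 0, and `exchange` transports it to every other
      -- coordinate.
      upper≋lower+μ : ∀ i → upper i ≈ lower i + μ
      upper≋lower+μ zero    = sym (proj₂ (proj₂ width))
      upper≋lower+μ (suc j) = +-cancelˡ (lower zero) _ _ (begin-equality
        lower zero + upper (suc j)       ≈⟨ exchange j ⟨
        upper zero + lower (suc j)       ≈⟨ +-congʳ (proj₂ (proj₂ width)) ⟨
        lower zero + μ + lower (suc j)   ≈⟨ solve 3 (λ u v w → u :+ v :+ w := u :+ (w :+ v)) refl _ μ _ ⟩
        lower zero + (lower (suc j) + μ) ∎)

      apex≋ : ∀ e → apex e ≋ lower ⊹ μ · proj₁ e
      apex≋ e i with proj₁ (proj₂ e) i
      ... | inj₁ ei≈0 = trans (apex-cong e (avoiding i) (trans ei≈0 (sym (avoiding-0 i))))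
                              (sym (trans (+-congˡ (trans (*-congˡ ei≈0) (zeroʳ μ))) (+-identityʳ _)))
      ... | inj₂ ei≈1 = trans (apex-cong e (containing i) (trans ei≈1 (sym (containing-1 i))))
                              (trans (upper≋lower+μ i) (+-congˡ (sym (trans (*-congˡ ei≈1) (*-identityʳ μ)))))

      -- The offset of q from `lower` lies in the box [0, μ]ⁿ. Its coordinate sum is found by
      -- comparing q with the apex of one vertex, whose form `apex≋` gives.
      Q⊆ : Q ⊆ translate lower (μ ⊙ hypersimplex n (ℕ.suc r))
      Q⊆ {q} q∈Q = x , ⊙-hypersimplex {r = ℕ.suc r} 0≤μ (proj₂ e) 0≤x≤μ ∑x≈
                 , λ i → trans (sym (lower+x≋q i)) (+-comm (lower i) (x i))
        where
        e : Vertex n (ℕ.suc r)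
        e = containing zero
        offset : ∀ i → ∃[ d ] 0# ≤ d × lower i + d ≈ q i
        offset i = ≤⇒gap (lower-≤ q∈Q i)
        x : Point n
        x i = proj₁ (offset i)
        lower+x≋q : lower ⊹ x ≋ q
        lower+x≋q i = proj₂ (proj₂ (offset i))
        0≤x≤μ : ∀ i → 0# ≤ x i × x i ≤ μ
        0≤x≤μ i = proj₁ (proj₂ (offset i))
                , +-cancelˡ-≤ (lower i) (≤-respˡ (sym (lower+x≋q i)) (≤-respʳ (upper≋lower+μ i) (≤-upper q∈Q i)))
        ∑x≈ : sum x ≈ μ * (ℕ.suc r ×ᴷ 1#)
        ∑x≈ = +-cancelˡ (sum lower) _ _ (begin-equality
          sum lower + sum x                    ≈⟨ ∑-distrib-+ lower x ⟨
          sum (lower ⊹ x)                      ≈⟨ sum-cong-≋ lower+x≋q ⟩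
          sum q                                ≈⟨ sum-constant e q∈Q ⟩
          sum (apex e)                         ≈⟨ sum-cong-≋ (apex≋ e) ⟩
          sum (lower ⊹ μ · proj₁ e)            ≈⟨ ∑-distrib-+ lower (μ · proj₁ e) ⟩
          sum lower + sum (μ · proj₁ e)        ≈⟨ +-congˡ (*-distribˡ-sum μ (proj₁ e)) ⟨
          sum lower + μ * sum (proj₁ e)        ≈⟨ +-congˡ (*-congˡ (proj₂ (proj₂ e))) ⟩
          sum lower + μ * (ℕ.suc r ×ᴷ 1#)      ∎)

      -- The homothety sends each vertex to its apex by `apex≋`, hence a convex combination of
      -- vertices to the same combination of apices, which lies in Q by convexity.
      Q⊇ : translate lower (μ ⊙ hypersimplex n (ℕ.suc r)) ⊆ Q
      Q⊇ {x} (p , (p′ , (k , ps , w , ps∈V , 0≤w , ∑w≈1 , p′≋) , p≋μp′) , x≋p+lower) =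
        convexQ (k , (λ j → apex (ps j , ps∈V j)) , w , (λ j → apex∈Q (ps j , ps∈V j)) , 0≤w , ∑w≈1 , x≋)
        where
        x≋ : ∀ i → x i ≈ sum (λ j → w j * apex (ps j , ps∈V j) i)
        x≋ i = begin-equality
          x i                                            ≈⟨ x≋p+lower i ⟩
          p i + lower i                                  ≈⟨ +-comm (p i) (lower i) ⟩
          lower i + p i                                  ≈⟨ +-cong (*-identityˡ (lower i)) (sym (p≋μp′ i)) ⟨
          1# * lower i + μ * p′ i                        ≈⟨ +-cong (*-congʳ (sym ∑w≈1)) (*-congˡ (p′≋ i)) ⟩
          sum w * lower i + μ * sum (λ j → w j * ps j i) ≈⟨ ∑-affine (lower i) μ w (λ j → ps j i) ⟨
          sum (λ j → w j * (lower i + μ * ps j i))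
            ≈⟨ sum-cong-≋ (λ j → *-congˡ (apex≋ (ps j , ps∈V j) i)) ⟨
          sum (λ j → w j * apex (ps j , ps∈V j) i)       ∎

    summand-homothetic : HomotheticTranslate Q (hypersimplex (2 ℕ.+ m) (ℕ.suc r))
    summand-homothetic = μ , lower , 0≤μ , Q⊆ , Q⊇

  hypersimplex-indecomposable : ∀ {m r} → r ℕ.≤ m → MinkowskiIndecomposable (hypersimplex (2 ℕ.+ m) (ℕ.suc r))
  hypersimplex-indecomposable r≤m c Q R (0≤c , _) polyQ polyR (cΔ⊆Q+R , Q+R⊆cΔ) =
      summand-homothetic r≤m 0≤c (polytope-convex polyQ) cΔ⊆Q+R Q+R⊆cΔ
    -- The roles of Q and R are exchanged by commutativity of the Minkowski sum.
    , summand-homothetic r≤m 0≤c (polytope-convex polyR) (λ x∈ → ⊕-comm (cΔ⊆Q+R x∈)) (λ x∈ → Q+R⊆cΔ (⊕-comm x∈))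
    where
    ⊕-comm : ∀ {n} {A B : PointSet n} → A ⊕ B ⊆ B ⊕ A
    ⊕-comm (a , b , a∈A , b∈B , x≋) = b , a , b∈B , a∈A , λ i → trans (x≋ i) (+-comm (a i) (b i))

-- The median hypersimplex.

open import Data.Nat using (_≤_; _*_)

theorem3p10 : (ℝ : RealNumbers) → let open Polytopes (RealNumbers.orderedField ℝ) in
    (k : ℕ) → 1 ≤ k → MinkowskiIndecomposable (hypersimplex (2 * k) k)
theorem3p10 ℝ (ℕ.suc k) 1≤k =
  -- Since 2(k + 1) = 2 + 2k, this is the case m = 2k, r = k, where r ≤ m reads k ≤ k + (k + 0).
  ≡.subst (λ n → MinkowskiIndecomposable (hypersimplex n (ℕ.suc k))) (≡.sym (ℕₚ.*-suc 2 k))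
    (hypersimplex-indecomposable (ℕₚ.m≤m+n k (k ℕ.+ 0)))
  where
  open Polytopes (RealNumbers.orderedField ℝ)
  open MinkowskiSummands (RealNumbers.orderedField ℝ)
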